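{- Let $d$ and $p$ be integers with $d>p\ge 2$ and let \[ f_{d,p}(m)=\sum_{j=1}^{p}\binom{j+m-2}{j-1}\binom{d-j+m}{d-j}. \] Then every integer $k$ with $-\left\lfloor\frac{d-1}{2}\right\rfloor\le k\le -1$ is a root of $f_{d,p}$.
   Context: For an integer $a\ge 0$, $\binom{a+x}{a}$ denotes the polynomial $\prod_{i=1}^{a}(x+i)/a!$ in $x$; so $\binom{j+m-2}{j-1}=\prod_{i=0}^{j-2}(m+i)/(j-1)!$ and $\binom{d-j+m}{d-j}=\prod_{i=1}^{d-j}(m+i)/(d-j)!$. -}

module Defs where

open import Data.Fin using (toℕ)
open import Data.Integer using (ℤ; +_)
open import Data.Nat using (ℕ; suc; _∸_; _!)
open import Data.Nat.Properties using (_!≢0)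
open import Data.Rational using (ℚ; 0ℚ; 1ℚ; _+_; _-_; _*_; _/_)
open import Data.Rational.Properties using (+-0-commutativeMonoid; *-1-commutativeMonoid)
open import Relation.Binary.PropositionalEquality using (_≡_)

open import Algebra.Properties.CommutativeMonoid.Sum +-0-commutativeMonoid
  using (sum-syntax)
open import Algebra.Properties.CommutativeMonoid.Sum *-1-commutativeMonoid
  using () renaming (sum to product)

-- Polynomials over ℚ are represented by their evaluation functions ℚ → ℚ;
-- as ℚ is infinite, no information is lost.

fromℤ : ℤ → ℚ
fromℤ k = k / 1

fromℕ : ℕ → ℚ
fromℕ n = fromℤ (+ n)

-- binom a x is the binomial coefficient "a + x choose a", that is
-- (x + 1) ⋯ (x + a) / a!; the index i < a contributes the factor x + (i + 1).
binom : ℕ → ℚ → ℚ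
binom a x = product {a} (λ i → x + fromℕ (suc (toℕ i))) * ((+ 1 / (a !)) {{a !≢0}})

-- The index i < p stands for the summand j = i + 1.  The first factor is
-- "j + m - 2 choose j - 1" = "a + x choose a" at a = j - 1 and x = m - 1.
-- The truncated subtraction d ∸ j is exact whenever p ≤ d.
f : (d p : ℕ) → ℚ → ℚ
f d p m = ∑[ i < p ] (let j = suc (toℕ i) in
  binom (j ∸ 1) (m - 1ℚ) * binom (d ∸ j) m)

IsRoot : (ℚ → ℚ) → ℚ → Set
IsRoot g x = g x ≡ 0ℚ

{-# OPTIONS --safe #-}
-- At k = -s with 1 ≤ s ≤ (d - 1) / 2 every summand vanishes: the first binomial
-- has the factor m + s when s ≤ j - 2, the second one when s ≤ d - j, and these
-- two ranges of j cover everything because 2 s ≤ d - 1.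
module Submission where

open import Data.Nat as ℕ using (ℕ; _∸_)
open import Data.Integer as ℤ using (ℤ; +_; -_; -1ℤ)
open import Data.Nat.DivMod using (_/_)
open import Defs

import Algebra.Properties.CommutativeMonoid.Sum as Sum
open import Data.Fin using (Fin; toℕ; fromℕ<)
open import Data.Fin.Properties using (toℕ-fromℕ<)
open import Data.Integer using (-[1+_])
import Data.Integer.Properties as ℤ
open import Data.Nat using (suc; _!)
import Data.Nat.Coprimality as Coprime
open import Data.Nat.DivMod using (m/n*n≤m)
import Data.Nat.Properties as ℕ
open import Data.Rational as ℚ using (ℚ; mkℚ; 0ℚ; 1ℚ)
import Data.Rational.Properties as ℚ
open import Data.Vec.Functional using (removeAt)
open import Relation.Binary.PropositionalEquality
open import Relation.Nullary using (yes; no)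

open Sum ℚ.+-0-commutativeMonoid using (sum; sum-cong-≗; sum-replicate-zero)
open Sum ℚ.*-1-commutativeMonoid using () renaming (sum to product; sum-remove to product-remove)
open ≡-Reasoning

zero-*ˡ : ∀ {p} q → p ≡ 0ℚ → p ℚ.* q ≡ 0ℚ
zero-*ˡ q refl = ℚ.*-zeroˡ q

zero-*ʳ : ∀ p {q} → q ≡ 0ℚ → p ℚ.* q ≡ 0ℚ
zero-*ʳ p refl = ℚ.*-zeroʳ p

product-zero : ∀ {n} (t : Fin n → ℚ) (i : Fin n) → t i ≡ 0ℚ → product t ≡ 0ℚ
product-zero {suc n} t i tᵢ≡0 =
  trans (product-remove {i = i} t) (zero-*ˡ (product (removeAt t i)) tᵢ≡0)

sum-zero : ∀ {n} (t : Fin n → ℚ) → (∀ i → t i ≡ 0ℚ) → sum t ≡ 0ℚ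
sum-zero {n} t t≡0 = trans (sum-cong-≗ t≡0) (sum-replicate-zero n)

-- `fromℤ` does not reduce on a variable. `integral` is the same number given directly in lowest
-- terms, and on such fractions addition unfolds.
fromℤ-+ : ∀ i j → fromℤ (i ℤ.+ j) ≡ fromℤ i ℚ.+ fromℤ j
fromℤ-+ i j = begin
  fromℤ (i ℤ.+ j)                        ≡⟨ cong fromℤ (cong₂ ℤ._+_ (ℤ.*-identityʳ i) (ℤ.*-identityʳ j)) ⟨
  fromℤ (i ℤ.* + 1 ℤ.+ j ℤ.* + 1)        ≡⟨⟩
  integral i ℚ.+ integral j              ≡⟨ cong₂ ℚ._+_ (ℚ.↥p/↧p≡p (integral i)) (ℚ.↥p/↧p≡p (integral j)) ⟨
  fromℤ i ℚ.+ fromℤ j                    ∎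
  where
  integral : ℤ → ℚ
  integral k = mkℚ k 0 (Coprime.sym (Coprime.1-coprimeTo ℤ.∣ k ∣))

fromℤ-pred : ∀ i → fromℤ i ℚ.- 1ℚ ≡ fromℤ (ℤ.pred i)
fromℤ-pred i = trans (ℚ.+-comm (fromℤ i) (ℚ.- 1ℚ)) (sym (fromℤ-+ -1ℤ i))

-- The factor of index `n` is `x + (n + 1)`; `n < a` says that it occurs.
binom-root : ∀ {a n} → n ℕ.< a → IsRoot (binom a) (fromℤ -[1+ n ])
binom-root {a} {n} n<a =
  zero-*ˡ ((+ 1 ℚ./ (a !)) {{a ℕ.!≢0}})
    (product-zero (λ i → fromℤ -[1+ n ] ℚ.+ fromℕ (suc (toℕ i))) (fromℕ< n<a) factor≡0)
  where
  factor≡0 : fromℤ -[1+ n ] ℚ.+ fromℕ (suc (toℕ (fromℕ< n<a))) ≡ 0ℚ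
  factor≡0 = begin
    fromℤ -[1+ n ] ℚ.+ fromℕ (suc (toℕ (fromℕ< n<a)))  ≡⟨ cong (λ m → fromℤ -[1+ n ] ℚ.+ fromℕ (suc m)) (toℕ-fromℕ< n<a) ⟩
    -- `fromℤ -[1+ n ]` unfolds to the negative of `fromℕ (suc n)`.
    fromℤ -[1+ n ] ℚ.+ fromℕ (suc n)                   ≡⟨ ℚ.+-inverseˡ (fromℕ (suc n)) ⟩
    0ℚ                                                 ∎

-- Here n = s - 1 and i = j - 1.
summand-root : ∀ d n i → suc n ℕ.* 2 ℕ.< d →
  IsRoot (λ m → binom i (m ℚ.- 1ℚ) ℚ.* binom (d ∸ suc i) m) (fromℤ -[1+ n ])
summand-root d n i 2s<d with suc n ℕ.<? i
... | yes s<i = zero-*ˡ (binom (d ∸ suc i) (fromℤ -[1+ n ])) left≡0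
  where
  -- The argument is shifted to `-(s + 1)`, so the vanishing factor has index `s`; hence the split
  -- at `s < i`.
  left≡0 : binom i (fromℤ -[1+ n ] ℚ.- 1ℚ) ≡ 0ℚ
  left≡0 = trans (cong (binom i) (fromℤ-pred -[1+ n ])) (binom-root s<i)
... | no s≮i = zero-*ʳ (binom i (fromℤ -[1+ n ] ℚ.- 1ℚ)) (binom-root n<d∸j)
  where
  s+i≤2s : suc n ℕ.+ i ℕ.≤ suc n ℕ.* 2
  s+i≤2s = subst (suc n ℕ.+ i ℕ.≤_)
    (trans (cong (suc n ℕ.+_) (sym (ℕ.+-identityʳ (suc n)))) (ℕ.*-comm 2 (suc n)))
    (ℕ.+-monoʳ-≤ (suc n) (ℕ.≮⇒≥ s≮i))

  -- From `i ≤ s`: `s + j = s + i + 1 ≤ 2 s + 1 ≤ d`, so `s ≤ d - j`.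
  n<d∸j : n ℕ.< d ∸ suc i
  n<d∸j = ℕ.m+n≤o⇒m≤o∸n (suc n)
    (subst (ℕ._≤ d) (sym (ℕ.+-suc (suc n) i)) (ℕ.≤-<-trans s+i≤2s 2s<d))

s≤[d-1]/2⇒2s<d : ∀ d s → 0 ℕ.< s → s ℕ.≤ (d ∸ 1) / 2 → s ℕ.* 2 ℕ.< d
-- Truncation makes the bound `0` at `d = 0`, contradicting `0 < s`.
s≤[d-1]/2⇒2s<d ℕ.zero    s 0<s s≤0 with () ← ℕ.<-≤-trans 0<s s≤0
s≤[d-1]/2⇒2s<d (suc d-1) s _   s≤h =
  ℕ.s≤s (ℕ.≤-trans (ℕ.*-monoˡ-≤ 2 s≤h) (m/n*n≤m d-1 2))

theorem2p7 : (d p : ℕ) → p ℕ.< d → 2 ℕ.≤ p →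
    (k : ℤ) → - (+ ((d ∸ 1) / 2)) ℤ.≤ k → k ℤ.≤ -1ℤ →
    IsRoot (f d p) (fromℤ k)
-- The bound `k ≤ -1` excludes nonnegative `k`, which leaves `k = -s` with `s = suc n`.
theorem2p7 d p _ _ -[1+ n ] -h≤k _ =
  sum-zero {p} _ λ i → summand-root d n (toℕ i) 2s<d
  where
  2s<d : suc n ℕ.* 2 ℕ.< d
  2s<d = s≤[d-1]/2⇒2s<d d (suc n) ℕ.z<s (ℤ.drop‿+≤+ (ℤ.neg-cancel-≤ -h≤k))
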